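{- Let $\mathcal{H}$ be a projection-closed class of graphs. Then one of the following holds: (i) $\mathcal{H}$ contains $K_t$ for every $t\ge 1$; (ii) $\mathcal{H}$ contains $K_{t,t,t}$ for every $t\ge 1$; (iii) there is a $\mu\ge 0$ such that every $H\in\mathcal{H}$ has distance at most $\mu$ to extended bicliques.
   Context: A graph $H'$ is a projection of $H$ if $H'$ can be obtained from $H$ by a sequence of vertex deletions and identifications of two nonadjacent vertices; a class of graphs (closed under isomorphism) is projection-closed if it contains every projection of each of its members. $K_{t,t,t}$ is the complete tripartite graph with three parts of size $t$. An extended biclique is a complete bipartite graph together with a set of isolated vertices; the distance of $H$ to extended bicliques is the minimum number of vertices to delete from $H$ to obtain an extended biclique. -}

module Defs where

open import Data.Bool.Base using (Bool; true; false; not; _∧_; _∨_)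
open import Data.Bool.Properties using (∨-comm)
open import Data.Fin.Base using (Fin; punchIn; quotient)
open import Data.Fin.Properties using (_≟_)
open import Data.Nat.Base using (ℕ; zero; suc; _*_; _≤_)
open import Data.Product.Base using (Σ-syntax; ∃-syntax; _×_)
open import Function.Base using (id)
open import Function.Bundles using (_↔_; Inverse)
open import Level using (Level) renaming (suc to lsuc)
open import Relation.Binary.PropositionalEquality
open import Relation.Nullary.Decidable using (does; yes; no)
open import Relation.Nullary.Negation using (contradiction)

private variable
  m n k : ℕ

-- Finite simple graphs on the vertex set Fin n.
record Graph (n : ℕ) : Set where
  field
    adj        : Fin n → Fin n → Bool
    adj-sym    : ∀ u v → adj u v ≡ adj v u
    adj-irrefl : ∀ v → adj v v ≡ false

open Graph public

infix 4 _≅_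

_≅_ : Graph m → Graph n → Set
_≅_ {m} {n} G H =
  Σ[ f ∈ Fin m ↔ Fin n ]
    (∀ u v → adj G u v ≡ adj H (Inverse.to f u) (Inverse.to f v))

-- punchIn v enumerates the vertices other than v.
delete : Graph (suc n) → Fin (suc n) → Graph n
delete G v .adj i j      = adj G (punchIn v i) (punchIn v j)
delete G v .adj-sym i j  = adj-sym G (punchIn v i) (punchIn v j)
delete G v .adj-irrefl i = adj-irrefl G (punchIn v i)

module _ (G : Graph n) (u v : Fin n) where

  -- Adjacency once u has additionally received all neighbours of v.
  absorbAdj : Fin n → Fin n → Bool
  absorbAdj a b = adj G a b ∨ ((does (a ≟ u) ∧ adj G v b) ∨ (does (b ≟ u) ∧ adj G v a))

  absorbAdj-sym : ∀ a b → absorbAdj a b ≡ absorbAdj b a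
  absorbAdj-sym a b = cong₂ _∨_ (adj-sym G a b)
    (∨-comm (does (a ≟ u) ∧ adj G v b) (does (b ≟ u) ∧ adj G v a))

  absorbAdj-irrefl : adj G u v ≡ false → ∀ a → absorbAdj a a ≡ false
  absorbAdj-irrefl u≁v a rewrite adj-irrefl G a with a ≟ u
  ... | no  _    = refl
  ... | yes refl rewrite adj-sym G v u | u≁v = refl

-- The merged vertex is u; the old vertex v is dropped, so this is the
-- identification of u and v only when u ≢ v.
identify : (G : Graph (suc n)) (u v : Fin (suc n)) → adj G u v ≡ false → Graph n
identify G u v u≁v .adj i j      = absorbAdj G u v (punchIn v i) (punchIn v j)
identify G u v u≁v .adj-sym i j  = absorbAdj-sym G u v (punchIn v i) (punchIn v j)
identify G u v u≁v .adj-irrefl i = absorbAdj-irrefl G u v u≁v (punchIn v i)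

data Projection {m} (G : Graph m) : ∀ {n} → Graph n → Set where
  start : Projection G G
  del   : {H : Graph (suc n)} → Projection G H →
          ∀ v → Projection G (delete H v)
  ident : {H : Graph (suc n)} → Projection G H →
          ∀ {u v} → u ≢ v → (u≁v : adj H u v ≡ false) →
          Projection G (identify H u v u≁v)

GraphClass : (ℓ : Level) → Set (lsuc ℓ)
GraphClass ℓ = ∀ {n} → Graph n → Set ℓ

record ProjectionClosed {ℓ} (𝓗 : GraphClass ℓ) : Set ℓ where
  field
    ≅-closed          : ∀ {m n} {G : Graph m} {H : Graph n} → G ≅ H → 𝓗 G → 𝓗 H
    projection-closed : ∀ {m n} {G : Graph m} {H : Graph n} → Projection G H → 𝓗 G → 𝓗 H

-- The complete k-partite graph whose i-th part is the fibre of part over i.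
completeMultipartite : (Fin n → Fin k) → Graph n
completeMultipartite part .adj u v = not (does (part u ≟ part v))
completeMultipartite part .adj-sym u v with part u ≟ part v | part v ≟ part u
... | yes _ | yes _ = refl
... | no  _ | no  _ = refl
... | yes p | no ¬q = contradiction (sym p) ¬q
... | no ¬p | yes q = contradiction (sym q) ¬p
completeMultipartite part .adj-irrefl v with part v ≟ part v
... | yes _ = refl
... | no ¬p = contradiction refl ¬p

K : ∀ t → Graph t
K t = completeMultipartite id

-- Fin (3 * t) split into three consecutive blocks of length t.
Kₜₜₜ : ∀ t → Graph (3 * t)
Kₜₜₜ t = completeMultipartite (quotient {3} t)

data Role : Set where
  left right isolated : Role

joined : Role → Role → Bool
joined left  right = true
joined right left  = true
joined _     _     = false

-- Either side of the biclique may be empty, so edgeless graphs qualify.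
ExtendedBiclique : Graph n → Set
ExtendedBiclique {n} G =
  Σ[ role ∈ (Fin n → Role) ] (∀ u v → adj G u v ≡ joined (role u) (role v))

-- Deletes d G H: H arises from G by deleting exactly d vertices.
data Deletes : ℕ → Graph m → Graph n → Set where
  none : {G : Graph n} → Deletes zero G G
  one  : ∀ {d} {G : Graph (suc m)} {H : Graph n} (v : Fin (suc m)) →
         Deletes d (delete G v) H → Deletes (suc d) G H

DeletableToExtendedBiclique : ℕ → Graph n → Set
DeletableToExtendedBiclique d G =
  ∃[ m ] Σ[ H ∈ Graph m ] (Deletes d G H × ExtendedBiclique H)

-- The distance as the minimum of a set of natural numbers, given by its graph.
IsDistance : Graph n → ℕ → Set
IsDistance G d =
  DeletableToExtendedBiclique d G × (∀ k → DeletableToExtendedBiclique k G → d ≤ k)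

DistanceAtMost : ℕ → Graph n → Set
DistanceAtMost μ G = ∃[ d ] (IsDistance G d × d ≤ μ)

{-# OPTIONS --safe #-}
module Submission where

open import Level using (Level; 0ℓ; Lift; lift; lower)
open import Axiom.ExcludedMiddle using (ExcludedMiddle)
open import Data.Bool.Base using (Bool; true; false; not; _∨_; if_then_else_)
import Data.Bool.Properties as Bool
open import Data.Empty using (⊥; ⊥-elim)
open import Data.Fin.Base using (Fin; zero; suc; punchIn; punchOut; quotient; combine; inject≤)
  renaming (_<_ to _<ᶠ_)
open import Data.Fin.Properties
  using ( _≟_; any?; <-cmp; <⇒≢; punchIn-punchOut; punchInᵢ≢i; punchIn-injective
        ; toℕ-inject≤; inject≤-injective; toℕ-combine; combine-monoˡ-<; combine-injective)
open import Data.List.Base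
  using (List; []; _∷_; length; map; concatMap; lookup; allFin; cartesianProduct)
open import Data.List.Membership.Propositional using (_∈_; _∉_)
open import Data.List.Membership.Propositional.Properties
  using (∈-map⁺; ∈-allFin; ∈-cartesianProduct⁺; ∈-concatMap⁺; ∈-lookup)
open import Data.List.Relation.Binary.Sublist.Propositional
  using (_⊆_; []; _∷_; _∷ʳ_; ⊆-trans; ⊆-refl; minimum)
open import Data.List.Relation.Binary.Sublist.Propositional.Properties using (All-resp-⊆)
open import Data.List.Relation.Unary.All as All using (All; []; _∷_)
open import Data.List.Relation.Unary.AllPairs using (AllPairs; []; _∷_)
open import Data.List.Relation.Unary.Any as Any using (here; there)
open import Data.Nat.Base using (ℕ; zero; suc; _+_; _*_; _≤_; _<_; _≥_; z≤n; s≤s)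
import Data.Nat.Properties as ℕ
open import Data.Product.Base using (Σ-syntax; ∃-syntax; _×_; _,_; proj₁; proj₂)
open import Data.Sum.Base using (_⊎_; inj₁; inj₂)
open import Function.Base using (_∘_; id)
open import Function.Bundles using (mk⇔; mk↔ₛ′)
open import Relation.Binary.Definitions using (tri<; tri≈; tri>)
open import Relation.Binary.PropositionalEquality
open import Relation.Nullary.Decidable
  using (Dec; yes; no; dec-true; dec-false; decidable-stable; map′; ¬?)
  renaming (_×-dec_ to _×?_)
open import Relation.Nullary.Negation using (¬_; contradiction)
open import Defs

-- Call a closed walk of six vertices hexagonal if its steps alternate between
-- edges and non-edges (a step may stay put as a non-edge).  A graph without
-- such walks is an extended biclique: fix an edge ab and compare every vertex
-- with a and b.  Hence a graph far from extended bicliques contains many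
-- disjoint hexagons, and by Ramsey's theorem many on which the adjacency
-- between the x-th vertex of one hexagon and the y-th of a later one depends
-- only on x and y.  If for consecutive x, y it differs from the adjacency
-- within a hexagon, or depends on the order of the two hexagons, then the two
-- columns of vertices contain a half graph, the complement of a matching or an
-- induced matching, and each of these projects to a large complete graph.
-- Otherwise the consecutive pairs form a blow-up of a hexagon; contracting the
-- three non-edges of the hexagon, one pair for each copy, gives Kₜₜₜ.

private variable
  ℓ     : Level
  k m n : ℕ
  A     : Set

adj-absurd : ∀ {b} {C : Set ℓ} → b ≡ true → b ≡ false → C
adj-absurd refl ()

adj-flip : ∀ (G : Graph n) {u v b} → adj G u v ≡ b → adj G v u ≡ b
adj-flip G = trans (adj-sym G _ _)

adj⇒≢ : ∀ (G : Graph n) {u v} → adj G u v ≡ true → u ≢ v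
adj⇒≢ G u~v refl = adj-absurd u~v (adj-irrefl G _)

-- An edge-surjective homomorphism onto H from the subgraph of G induced by
-- the vertices e x; e need not be injective.
record IsModel (G : Graph n) (H : Graph k) {I : Set}
               (e : I → Fin n) (c : I → Fin k) : Set where
  field
    consistent : ∀ {x y} → e x ≡ e y → c x ≡ c y
    surjective : ∀ p → ∃[ x ] c x ≡ p
    hom        : ∀ {x y} → adj G (e x) (e y) ≡ true → adj H (c x) (c y) ≡ true
    lifts      : ∀ {p q} → adj H p q ≡ true →
                 ∃[ x ] ∃[ y ] c x ≡ p × c y ≡ q × adj G (e x) (e y) ≡ true

-- Models as projections

module _ {𝓗 : GraphClass ℓ} (closed : ProjectionClosed 𝓗) where
  open ProjectionClosed closed
  open IsModel

  -- Two vertices with the same class are nonadjacent, since `H` has no loops, so they can be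
  -- identified; this is repeated until `c` is injective. Then `surjective` makes `c` a bijection
  -- and `lifts` makes it reflect edges, so `c` is an isomorphism.
  quotient-member : ∀ {n} {G : Graph n} {H : Graph k} (c : Fin n → Fin k) →
                    IsModel G H id c → 𝓗 G → 𝓗 H
  quotient-member {n = n} {G} {H} c M G∈𝓗
    with any? (λ u → any? λ v → c u ≟ c v ×? ¬? (u ≟ v))
  quotient-member {n = n} {G} {H} c M G∈𝓗 | no ¬dup = ≅-closed (c↔ , adj≡) G∈𝓗
    where
    c-injective : ∀ {u v} → c u ≡ c v → u ≡ v
    c-injective {u} {v} cu≡cv =
      decidable-stable (u ≟ v) λ u≢v → ¬dup (u , v , cu≡cv , u≢v)

    c↔ = mk↔ₛ′ c (λ p → proj₁ (surjective M p)) (λ p → proj₂ (surjective M p))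
           (λ v → c-injective (proj₂ (surjective M (c v))))

    adj≡ : ∀ u v → adj G u v ≡ adj H (c u) (c v)
    adj≡ u v = Bool.⇔→≡ (mk⇔ (hom M) reflect)
      where
      reflect : adj H (c u) (c v) ≡ true → adj G u v ≡ true
      reflect cu~cv with x , y , cx , cy , x~y ← lifts M cu~cv
        with refl ← c-injective cx | refl ← c-injective cy = x~y
  quotient-member {n = suc n} {G} {H} c M G∈𝓗 | yes (u , v , cu≡cv , u≢v) =
    quotient-member (c ∘ punchIn v) M′
      (projection-closed (ident start u≢v u≁v) G∈𝓗)
    where
    u≁v : adj G u v ≡ false
    u≁v = Bool.¬-not λ u~v → adj⇒≢ H (hom M u~v) cu≡cv

    G′ = identify G u v u≁v

    -- The vertex of `G′` that `x` becomes: the dropped vertex `v` is represented by `u`, every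
    -- other vertex by itself.
    rep : ∀ x → ∃[ i ] ((x ≡ v × punchIn v i ≡ u) ⊎ punchIn v i ≡ x)
    rep x with v ≟ x
    ... | yes refl = punchOut (u≢v ∘ sym) , inj₁ (refl , punchIn-punchOut (u≢v ∘ sym))
    ... | no  v≢x  = punchOut v≢x , inj₂ (punchIn-punchOut v≢x)

    rep-class : ∀ x → c (punchIn v (proj₁ (rep x))) ≡ c x
    rep-class x with rep x
    ... | i , inj₁ (refl , eq) = trans (cong c eq) cu≡cv
    ... | i , inj₂ eq          = cong c eq

    hom′ : ∀ i j → adj G′ i j ≡ true → adj H (c (punchIn v i)) (c (punchIn v j)) ≡ true
    hom′ i j i~j with adj G (punchIn v i) (punchIn v j) in eq
    ... | true = hom M eq
    ... | false with punchIn v i ≟ u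
    hom′ i j i~j | false | yes refl with adj G v (punchIn v j) in eq′
    ... | true = trans (cong (λ p → adj H p (c (punchIn v j))) cu≡cv) (hom M eq′)
    hom′ i j i~j | false | yes refl | false with punchIn v j ≟ u
    ... | yes eq″ = adj-absurd i~j (trans (cong (adj G v) (sym eq″)) eq′)
    ... | no  _   = adj-absurd i~j refl
    hom′ i j i~j | false | no _ with punchIn v j ≟ u
    ... | yes refl = adj-flip H
                       (trans (cong (λ p → adj H p (c (punchIn v i))) cu≡cv) (hom M i~j))
    ... | no  _    = adj-absurd i~j refl

    rep-adj : ∀ x y → adj G x y ≡ true → adj G′ (proj₁ (rep x)) (proj₁ (rep y)) ≡ true
    rep-adj x y x~y with rep x | rep y
    ... | i , inj₂ refl | j , inj₂ refl rewrite x~y = refl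
    ... | i , inj₁ (refl , eq) | j , inj₁ (refl , _) = adj-absurd x~y (adj-irrefl G v)
    ... | i , inj₁ (refl , eq) | j , inj₂ refl
      rewrite dec-true (punchIn v i ≟ u) eq | x~y = Bool.∨-zeroʳ _
    ... | i , inj₂ refl | j , inj₁ (refl , eq)
      rewrite dec-true (punchIn v j ≟ u) eq | adj-sym G v (punchIn v i) | x~y =
        trans (cong (adj G (punchIn v i) (punchIn v j) ∨_) (Bool.∨-zeroʳ _)) (Bool.∨-zeroʳ _)

    M′ : IsModel G′ H id (c ∘ punchIn v)
    M′ .consistent refl = refl
    M′ .surjective p with x , refl ← surjective M p = proj₁ (rep x) , rep-class x
    M′ .hom {i} {j} = hom′ i j
    M′ .lifts p~q with x , y , refl , refl , x~y ← lifts M p~q =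
      _ , _ , rep-class x , rep-class y , rep-adj x y x~y

  module _ (em : ExcludedMiddle 0ℓ) where

    -- Vertices outside the image of `e` are deleted one by one. Once `e` is onto, a section of `e`
    -- turns `c` into a map on vertices, and `consistent` makes the classes independent of the
    -- section chosen. As `I` is an arbitrary set, excluded middle decides what lies in the image.
    model-member : ∀ {n} {G : Graph n} {H : Graph k} {I : Set} {e : I → Fin n} {c : I → Fin k} →
                   IsModel G H e c → 𝓗 G → 𝓗 H
    model-member {n = n} {G} {H} {I} {e} {c} M G∈𝓗 with em {∃[ v ] ∀ x → v ≢ e x}
    model-member {n = suc n} {G} {H} {I} {e} {c} M G∈𝓗 | yes (v , v≢e) =
      model-member M′ (projection-closed (del start v) G∈𝓗)
      where
      e′ : I → Fin n
      e′ x = punchOut (v≢e x)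

      adj-e′ : ∀ x y → adj (delete G v) (e′ x) (e′ y) ≡ adj G (e x) (e y)
      adj-e′ x y = cong₂ (adj G) (punchIn-punchOut (v≢e x)) (punchIn-punchOut (v≢e y))

      M′ : IsModel (delete G v) H e′ c
      M′ .consistent {x} {y} eq = consistent M
        (trans (sym (punchIn-punchOut (v≢e x))) (trans (cong (punchIn v) eq) (punchIn-punchOut (v≢e y))))
      M′ .surjective = surjective M
      M′ .hom {x} {y} x~y = hom M (trans (sym (adj-e′ x y)) x~y)
      M′ .lifts p~q with x , y , cx , cy , x~y ← lifts M p~q =
        x , y , cx , cy , trans (adj-e′ x y) x~y
    model-member {n = n} {G} {H} {I} {e} {c} M G∈𝓗 | no ¬missed = quotient-member (c ∘ s) M′ G∈𝓗
      where
      preimage : ∀ v → ∃[ x ] e x ≡ v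
      preimage v with em {∃[ x ] e x ≡ v}
      ... | yes found = found
      ... | no  ∄x    = contradiction (v , λ x eq → ∄x (x , sym eq)) ¬missed

      s : Fin n → I
      s v = proj₁ (preimage v)

      e∘s : ∀ v → e (s v) ≡ v
      e∘s v = proj₂ (preimage v)

      class-e : ∀ x → c (s (e x)) ≡ c x
      class-e x = consistent M (e∘s (e x))

      M′ : IsModel G H id (c ∘ s)
      M′ .consistent refl = refl
      M′ .surjective p with x , refl ← surjective M p = e x , class-e x
      M′ .hom {u} {v} u~v = hom M (trans (cong₂ (adj G) (e∘s u) (e∘s v)) u~v)
      M′ .lifts p~q with x , y , refl , refl , x~y ← lifts M p~q =
        e x , e y , class-e x , class-e y , x~y

-- Deleting vertices

-- `Deletes` is built from its first deletion, whereas `avoid` finds the next vertex to delete in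
-- the graph already reduced.
deletes-snoc : ∀ {d} {G : Graph m} {H : Graph (suc n)} (v : Fin (suc n)) →
               Deletes d G H → Deletes (suc d) G (delete H v)
deletes-snoc v none      = one v none
deletes-snoc v (one u p) = one u (deletes-snoc v p)

-- Each deletion renumbers the remaining vertices; `embed` keeps their names in `G`. A repeated
-- entry of `L` is deleted only once, hence a mere bound on `count`.
record Avoiding (G : Graph n) (L : List (Fin n)) : Set where
  field
    {count order} : ℕ
    count≤        : count ≤ length L
    {rest}        : Graph order
    deletes       : Deletes count G rest
    embed         : Fin order → Fin n
    injective     : ∀ {i j} → embed i ≡ embed j → i ≡ j
    embed∉        : ∀ i → embed i ∉ L
    adj-embed     : ∀ i j → adj rest i j ≡ adj G (embed i) (embed j)

avoid : ∀ (G : Graph n) L → Avoiding G L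
avoid G [] = record
  { count≤ = z≤n ; deletes = none ; embed = id ; injective = id
  ; embed∉ = λ _ () ; adj-embed = λ _ _ → refl }
avoid G (x ∷ L) with avoid G L
... | R with any? (λ i → Avoiding.embed R i ≟ x)
...   | no ∄i = record
  { count≤    = ℕ.m≤n⇒m≤1+n count≤
  ; deletes   = deletes
  ; embed     = embed
  ; injective = injective
  ; embed∉    = λ { i (here eq) → ∄i (i , eq) ; i (there i∈L) → embed∉ i i∈L }
  ; adj-embed = adj-embed
  } where open Avoiding R
avoid G (x ∷ L)
    | record { order = suc o ; count≤ = c≤ ; deletes = ds ; embed = e
             ; injective = e-inj ; embed∉ = e∉ ; adj-embed = adj-e }
      | yes (i , refl) = record
  { count≤    = s≤s c≤
  ; deletes   = deletes-snoc i ds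
  ; embed     = e ∘ punchIn i
  ; injective = punchIn-injective i _ _ ∘ e-inj
  ; embed∉    = λ { j (here eq) → punchInᵢ≢i i j (e-inj eq) ; j (there j∈L) → e∉ _ j∈L }
  ; adj-embed = λ j k → adj-e _ _
  }

-- Alternating hexagons

next : Fin 3 → Fin 3
next zero             = suc zero
next (suc zero)       = suc (suc zero)
next (suc (suc zero)) = zero

-- Identifying the two corners of each part turns a hexagon into a triangle.
-- Corners may coincide: K₃, P₄ and 2K₂ all contain hexagons.
record Hexagon (G : Graph n) : Set where
  field
    corner : Fin 3 → Bool → Fin n
    link   : ∀ p → adj G (corner p true) (corner (next p) false) ≡ true
    gap    : ∀ p → adj G (corner p true) (corner p false) ≡ false

open Hexagon

gap-any : ∀ {G : Graph n} (w : Hexagon G) p b c → adj G (corner w p b) (corner w p c) ≡ false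
gap-any {G = G} w p true  true  = adj-irrefl G _
gap-any {G = G} w p true  false = gap w p
gap-any {G = G} w p false true  = adj-flip G (gap w p)
gap-any {G = G} w p false false = adj-irrefl G _

-- The letter of a vertex names its part and the subscript its link; the walk is `x₁ y₁ y₂ z₂ z₃ x₃`
-- and back to `x₁`.
hexagon : ∀ (G : Graph n) {x₁ y₁ y₂ z₂ z₃ x₃} →
          adj G x₁ y₁ ≡ true → adj G y₁ y₂ ≡ false →
          adj G y₂ z₂ ≡ true → adj G z₂ z₃ ≡ false →
          adj G z₃ x₃ ≡ true → adj G x₃ x₁ ≡ false → Hexagon G
hexagon {n} G {x₁} {y₁} {y₂} {z₂} {z₃} {x₃} x~y y≁y y~z z≁z z~x x≁x =
  record { corner = at ; link = link′ ; gap = gap′ }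
  where
  at : Fin 3 → Bool → Fin n
  at zero             true  = x₁
  at zero             false = x₃
  at (suc zero)       true  = y₂
  at (suc zero)       false = y₁
  at (suc (suc zero)) true  = z₃
  at (suc (suc zero)) false = z₂

  link′ : ∀ p → adj G (at p true) (at (next p) false) ≡ true
  link′ zero             = x~y
  link′ (suc zero)       = y~z
  link′ (suc (suc zero)) = z~x

  gap′ : ∀ p → adj G (at p true) (at p false) ≡ false
  gap′ zero             = adj-flip G x≁x
  gap′ (suc zero)       = adj-flip G y≁y
  gap′ (suc (suc zero)) = adj-flip G z≁z

-- Hexagon-free graphs

module _ (G : Graph n) (hexagonFree : ¬ Hexagon G) where

  private
    -- A triangle is a hexagon that stays put at each of its non-edges.
    no-triangle : ∀ {u v w} → adj G u v ≡ true → adj G v w ≡ true → adj G w u ≡ true → ⊥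
    no-triangle u~v v~w w~u = hexagonFree
      (hexagon G u~v (adj-irrefl G _) v~w (adj-irrefl G _) w~u (adj-irrefl G _))

  module _ {a b} (a~b : adj G a b ≡ true) where

    private
      side : Bool → Bool → Role
      side true  _     = left
      side false true  = right
      side false false = isolated

      -- Neighbours of `b` join the side of `a`, and neighbours of `a` the side of `b`; no vertex is
      -- both, by `no-triangleᵃᵇ`.
      role : Fin n → Role
      role v = side (adj G v b) (adj G v a)

      no-triangleᵃᵇ : ∀ {u} → adj G u a ≡ true → adj G u b ≡ true → ⊥
      no-triangleᵃᵇ u~a u~b = no-triangle u~a a~b (adj-flip G u~b)

      -- The forbidden walk is `u v a b b a`, which runs through the edge `a b` forth and back.
      meets-a : ∀ {u v} → adj G u a ≡ false → adj G v a ≡ false → adj G u v ≡ false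
      meets-a u≁a v≁a = Bool.¬-not λ u~v → hexagonFree
        (hexagon G u~v v≁a a~b (adj-irrefl G _) (adj-flip G a~b) (adj-flip G u≁a))

      meets-b : ∀ {u v} → adj G u b ≡ false → adj G v b ≡ false → adj G u v ≡ false
      meets-b u≁b v≁b = Bool.¬-not λ u~v → hexagonFree
        (hexagon G u~v v≁b (adj-flip G a~b) (adj-irrefl G _) a~b (adj-flip G u≁b))

      -- The forbidden walk is `u b b a a v`, along a path whose ends are nonadjacent.
      crosses : ∀ {u v} → adj G u b ≡ true → adj G v a ≡ true → adj G u v ≡ true
      crosses u~b v~a = Bool.¬-not λ u≁v → hexagonFree
        (hexagon G u~b (adj-irrefl G _) (adj-flip G a~b) (adj-irrefl G _) (adj-flip G v~a) (adj-flip G u≁v))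

      apart : ∀ {u v w} → adj G u w ≡ true → adj G v w ≡ true → adj G u v ≡ false
      apart u~w v~w = Bool.¬-not λ u~v → no-triangle u~v v~w (adj-flip G u~w)

      adj-joined : ∀ u v → adj G u v ≡ joined (role u) (role v)
      adj-joined u v
        with adj G u b in ub | adj G u a in ua | adj G v b in vb | adj G v a in va
      ... | true  | true  | _     | _     = ⊥-elim (no-triangleᵃᵇ ua ub)
      ... | true  | false | true  | _     = apart ub vb
      ... | true  | false | false | true  = crosses ub va
      ... | true  | false | false | false = meets-a ua va
      ... | false | true  | true  | _     = adj-flip G (crosses vb ua)
      ... | false | true  | false | true  = apart ua va
      ... | false | true  | false | false = meets-b ub vb
      ... | false | false | true  | true  = ⊥-elim (no-triangleᵃᵇ va vb)
      ... | false | false | true  | false = meets-a ua va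
      ... | false | false | false | true  = meets-b ub vb
      ... | false | false | false | false = meets-b ub vb

    edge⇒extendedBiclique : ExtendedBiclique G
    edge⇒extendedBiclique = role , adj-joined

  hexagonFree⇒extendedBiclique : ExtendedBiclique G
  hexagonFree⇒extendedBiclique with any? (λ a → any? λ b → adj G a b Bool.≟ true)
  ... | yes (a , b , a~b) = edge⇒extendedBiclique a~b
  ... | no  edgeless      = (λ _ → isolated) , λ u v → Bool.¬-not λ u~v → edgeless (u , v , u~v)

-- Packing disjoint hexagons

cornerAt : {G : Graph n} → Hexagon G → Fin 3 × Bool → Fin n
cornerAt w (p , b) = corner w p b

Disjoint : {G : Graph n} → Hexagon G → Hexagon G → Set
Disjoint w w′ = ∀ x y → cornerAt w x ≢ cornerAt w′ y

positions : List (Fin 3 × Bool)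
positions = cartesianProduct (allFin 3) (true ∷ false ∷ [])

∈-positions : ∀ x → x ∈ positions
∈-positions (p , b) = ∈-cartesianProduct⁺ (∈-allFin p) (∈-bools b)
  where
  ∈-bools : ∀ b → b ∈ true ∷ false ∷ []
  ∈-bools true  = here refl
  ∈-bools false = there (here refl)

corners : {G : Graph n} → Hexagon G → List (Fin n)
corners w = map (cornerAt w) positions

length-corners : ∀ {G : Graph n} (ws : List (Hexagon G)) → length (concatMap corners ws) ≡ length ws * 6
length-corners []       = refl
length-corners (w ∷ ws) = cong (6 +_) (length-corners ws)

module _ (em : ExcludedMiddle 0ℓ) where

  -- Greedy choice: delete all corners of the hexagons found so far, at most six for each. A hexagon
  -- in the remainder enlarges the packing; if there is none, the remainder is an extended biclique.
  pack : ∀ N (G : Graph n) →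
         (∃[ d ] d ≤ N * 6 × DeletableToExtendedBiclique d G)
         ⊎ (Σ[ ws ∈ List (Hexagon G) ] length ws ≡ N × AllPairs Disjoint ws)
  pack zero    G = inj₂ ([] , refl , [])
  pack (suc N) G with pack N G
  ... | inj₁ (d , d≤ , D) = inj₁ (d , ℕ.m≤n⇒m≤o+n 6 d≤ , D)
  ... | inj₂ (ws , refl , disjoint) = grow (em {Hexagon rest})
    where
    open Avoiding (avoid G (concatMap corners ws))

    grow : Dec (Hexagon rest) → _
    grow (no free) = inj₁ (count ,
      ℕ.m≤n⇒m≤o+n 6 (ℕ.≤-trans count≤ (ℕ.≤-reflexive (length-corners ws))) ,
      order , rest , deletes , hexagonFree⇒extendedBiclique rest free)
    grow (yes h) = inj₂ (w ∷ ws , refl , All.tabulate new ∷ disjoint)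
      where
      w : Hexagon G
      w .corner p b = embed (corner h p b)
      w .link p     = trans (sym (adj-embed _ _)) (link h p)
      w .gap p      = trans (sym (adj-embed _ _)) (gap h p)

      new : ∀ {w′} → w′ ∈ ws → Disjoint w w′
      new {w′} w′∈ws x y eq = embed∉ (cornerAt h x)
        (∈-concatMap⁺ corners (Any.map (λ { refl → subst (_∈ corners w′) (sym eq)
          (∈-map⁺ (cornerAt w′) (∈-positions y)) }) w′∈ws))

  -- Induction on the bound `b`. If no witness is at most `b`, then a witness `d` at most `suc b` is
  -- itself least.
  least : (P : ℕ → Set) → ∀ {b} d → d ≤ b → P d → ∃[ c ] ((P c × (∀ k → P k → c ≤ k)) × c ≤ b)
  least P {zero}  zero z≤n Pd = zero , (Pd , λ _ _ → z≤n) , z≤n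
  least P {suc b} d    d≤  Pd with em {∃[ c ] c ≤ b × P c}
  ... | yes (c , c≤b , Pc) with e , min , e≤b ← least P c c≤b Pc = e , min , ℕ.m≤n⇒m≤1+n e≤b
  ... | no ∄c = d , (Pd , λ k Pk → ℕ.≮⇒≥ λ k<d → ∄c (k , ℕ.≤-pred (ℕ.≤-trans k<d d≤) , Pk)) , d≤

  deletable⇒distance : ∀ {μ d} {G : Graph n} → d ≤ μ → DeletableToExtendedBiclique d G → DistanceAtMost μ G
  deletable⇒distance {d = d} {G} = least (λ k → DeletableToExtendedBiclique k G) d

-- Ramsey's theorem for lists

AllPairs-resp-⊆ : ∀ {R : A → A → Set} {xs ys} → xs ⊆ ys → AllPairs R ys → AllPairs R xs
AllPairs-resp-⊆ []          []       = []
AllPairs-resp-⊆ (_ ∷ʳ s)    (_ ∷ rs) = AllPairs-resp-⊆ s rs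
AllPairs-resp-⊆ (refl ∷ s)  (r ∷ rs) = All-resp-⊆ s r ∷ AllPairs-resp-⊆ s rs

separate : (f : A → Bool) (xs : List A) →
           ∃[ ys ] ∃[ zs ] ys ⊆ xs × All (λ y → f y ≡ true) ys
                         × zs ⊆ xs × All (λ z → f z ≡ false) zs
                         × length ys + length zs ≡ length xs
separate f []       = [] , [] , [] , [] , [] , [] , refl
separate f (x ∷ xs) with ys , zs , ys⊆ , fys , zs⊆ , fzs , eq ← separate f xs | f x in fx
... | true  = x ∷ ys , zs , refl ∷ ys⊆ , fx ∷ fys , x ∷ʳ zs⊆ , fzs , cong suc eq
... | false = ys , x ∷ zs , x ∷ʳ ys⊆ , fys , refl ∷ zs⊆ , fx ∷ fzs ,
              trans (ℕ.+-suc _ _) (cong suc eq)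

Monochromatic : (A → A → Bool) → List A → Set
Monochromatic q xs = ∃[ b ] AllPairs (λ x y → q x y ≡ b) xs

ramseyNumber : ℕ → ℕ → ℕ
ramseyNumber zero    _       = zero
ramseyNumber (suc a) zero    = zero
ramseyNumber (suc a) (suc b) = suc (ramseyNumber a (suc b) + ramseyNumber (suc a) b)

-- `q` need not be symmetric: only pairs in list order are coloured. The head splits the tail by its
-- colour to the later elements, and it extends a set of that colour found in the corresponding
-- half.
ramsey : ∀ (q : A → A → Bool) a b xs → ramseyNumber a b ≤ length xs →
         (∃[ ys ] ys ⊆ xs × a ≤ length ys × AllPairs (λ x y → q x y ≡ true) ys)
         ⊎ (∃[ ys ] ys ⊆ xs × b ≤ length ys × AllPairs (λ x y → q x y ≡ false) ys)
ramsey q zero    b       xs _ = inj₁ ([] , minimum xs , z≤n , [])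
ramsey q (suc a) zero    xs _ = inj₂ ([] , minimum xs , z≤n , [])
ramsey q (suc a) (suc b) (x ∷ xs) (s≤s R≤)
  with ys , zs , ys⊆ , qys , zs⊆ , qzs , eq ← separate (q x) xs
  with ramseyNumber a (suc b) ℕ.≤? length ys
... | yes enough with ramsey q a (suc b) ys enough
...   | inj₁ (us , us⊆ , a≤ , quu) =
        inj₁ (x ∷ us , refl ∷ ⊆-trans us⊆ ys⊆ , s≤s a≤ , All-resp-⊆ us⊆ qys ∷ quu)
...   | inj₂ (us , us⊆ , b≤ , quu) = inj₂ (us , x ∷ʳ ⊆-trans us⊆ ys⊆ , b≤ , quu)
ramsey q (suc a) (suc b) (x ∷ xs) (s≤s R≤)
    | no few with ramsey q (suc a) b zs
                    -- If `zs` were too short as well, the two halves together would be shorter than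
                    -- `xs`.
                    (ℕ.≮⇒≥ λ zs< → ℕ.<⇒≱ (ℕ.+-mono-< (ℕ.≰⇒> few) zs<) (ℕ.≤-trans R≤ (ℕ.≤-reflexive (sym eq))))
...   | inj₁ (us , us⊆ , a≤ , quu) = inj₁ (us , x ∷ʳ ⊆-trans us⊆ zs⊆ , a≤ , quu)
...   | inj₂ (us , us⊆ , b≤ , quu) =
        inj₂ (x ∷ us , refl ∷ ⊆-trans us⊆ zs⊆ , s≤s b≤ , All-resp-⊆ us⊆ qzs ∷ quu)

iteratedRamseyNumber : {K : Set} → List K → ℕ → ℕ
iteratedRamseyNumber []       m = m
iteratedRamseyNumber (_ ∷ ks) m = ramseyNumber (iteratedRamseyNumber ks m) (iteratedRamseyNumber ks m)

module _ {K : Set} (q : K → A → A → Bool) where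

  -- The colourings are treated one after another; passing to a sublist keeps the earlier ones
  -- monochromatic.
  iterated-ramsey : ∀ ks m xs → iteratedRamseyNumber ks m ≤ length xs →
                    ∃[ ys ] ys ⊆ xs × m ≤ length ys × All (λ k → Monochromatic (q k) ys) ks
  iterated-ramsey []       m xs m≤ = xs , ⊆-refl , m≤ , []
  iterated-ramsey (k ∷ ks) m xs R≤ with ramsey (q k) _ _ xs R≤
  ... | inj₁ (ys , ys⊆ , ≤ys , mono) with zs , zs⊆ , m≤ , all ← iterated-ramsey ks m ys ≤ys =
        zs , ⊆-trans zs⊆ ys⊆ , m≤ , (true , AllPairs-resp-⊆ zs⊆ mono) ∷ all
  ... | inj₂ (ys , ys⊆ , ≤ys , mono) with zs , zs⊆ , m≤ , all ← iterated-ramsey ks m ys ≤ys =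
        zs , ⊆-trans zs⊆ ys⊆ , m≤ , (false , AllPairs-resp-⊆ zs⊆ mono) ∷ all

AllPairs-lookup : ∀ {R : A → A → Set} {xs} → AllPairs R xs →
                  ∀ {i j} → i <ᶠ j → R (lookup xs i) (lookup xs j)
AllPairs-lookup (r ∷ rs) {zero}  {suc j} _         = All.lookup r (∈-lookup j)
AllPairs-lookup (r ∷ rs) {suc i} {suc j} (s≤s i<j) = AllPairs-lookup rs i<j

inject≤-mono-< : ∀ {i j : Fin m} .(m≤n : m ≤ n) → i <ᶠ j → inject≤ i m≤n <ᶠ inject≤ j m≤n
inject≤-mono-< {i = i} {j} m≤n i<j =
  subst₂ _<_ (sym (toℕ-inject≤ i m≤n)) (sym (toℕ-inject≤ j m≤n)) i<j

-- Complete graphs from two columns of vertices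

K-adj : ∀ {p q : Fin k} → p ≢ q → adj (K k) p q ≡ true
K-adj {p = p} {q} p≢q = cong not (dec-false (p ≟ q) p≢q)

-- For a complete target, a homomorphism only requires independent classes, and by symmetry each
-- pair of classes needs an edge in one order only.
complete-model : ∀ {G : Graph n} {I : Set} {e : I → Fin n} {c : I → Fin k} →
                 (∀ {x y} → e x ≡ e y → c x ≡ c y) →
                 (∀ p → ∃[ x ] c x ≡ p) →
                 (∀ {x y} → c x ≡ c y → adj G (e x) (e y) ≡ false) →
                 (∀ {p q} → p <ᶠ q → ∃[ x ] ∃[ y ] c x ≡ p × c y ≡ q × adj G (e x) (e y) ≡ true) →
                 IsModel G (K k) e c
complete-model {k = k} {G = G} {e = e} {c} consistent surjective independent joins = record
  { consistent = consistent
  ; surjective = surjective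
  ; hom        = λ x~y → K-adj λ cx≡cy → adj-absurd x~y (independent cx≡cy)
  ; lifts      = lifts
  }
  where
  lifts : ∀ {p q} → adj (K k) p q ≡ true → ∃[ x ] ∃[ y ] c x ≡ p × c y ≡ q × adj G (e x) (e y) ≡ true
  lifts {p} {q} p~q with <-cmp p q
  ... | tri< p<q _ _  = joins p<q
  ... | tri≈ _ refl _ = adj-absurd p~q (adj-irrefl (K k) p)
  ... | tri> _ _ q<p with x , y , cx , cy , x~y ← joins q<p =
        y , x , cy , cx , adj-flip G x~y

module Columns {G : Graph n} (a : Bool → Fin m → Fin n)
               (distinct : ∀ β γ {i j} → i ≢ j → a β i ≢ a γ j)
               (s : ℕ) (s*[2+s]≤m : s * (2 + s) ≤ m) where

  private
    -- The indices are cut into `s` consecutive blocks of length `2 + s`, in increasing order.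
    -- Positions 0 and 1 serve the half graph, position 0 the co-matching, and positions `2 + j` the
    -- matching.
    cell : Fin s → Fin (2 + s) → Fin m
    cell i j = inject≤ (combine i j) s*[2+s]≤m

    cell-injective : ∀ {i j k l} → cell i j ≡ cell k l → i ≡ k × j ≡ l
    cell-injective eq = combine-injective _ _ _ _ (inject≤-injective _ _ _ _ eq)

    cell-mono : ∀ {i k} j l → i <ᶠ k → cell i j <ᶠ cell k l
    cell-mono j l i<k = inject≤-mono-< s*[2+s]≤m (combine-monoˡ-< j l i<k)

    cell₀<cell₁ : ∀ i → cell i zero <ᶠ cell i (suc zero)
    cell₀<cell₁ i = inject≤-mono-< s*[2+s]≤m
      (subst₂ _<_ (sym (toℕ-combine i _)) (sym (toℕ-combine i _)) (ℕ.+-monoʳ-< _ (s≤s z≤n)))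

    column : ∀ {β γ i j} → a β i ≡ a γ j → i ≡ j
    column {i = i} {j} eq = decidable-stable (i ≟ j) λ i≢j → distinct _ _ i≢j eq

  -- Shifting one column by one step against the other makes the two vertices
  -- of each class nonadjacent, whatever the edges a β i — a (not β) i are.
  halfGraph-model : ∀ β → (∀ {i j} → i <ᶠ j → adj G (a β i) (a (not β) j) ≡ true) →
                    (∀ {i j} → i <ᶠ j → adj G (a (not β) i) (a β j) ≡ false) →
                    ∃[ e ] IsModel G (K s) {Fin s × Bool} e proj₁
  halfGraph-model β up down = e , complete-model
    (λ { {_ , true} {_ , true} eq → proj₁ (cell-injective (column eq))
       ; {_ , true} {_ , false} eq → proj₁ (cell-injective (column eq))
       ; {_ , false} {_ , true} eq → proj₁ (cell-injective (column eq))
       ; {_ , false} {_ , false} eq → proj₁ (cell-injective (column eq)) })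
    (λ p → (p , true) , refl)
    (λ { {_ , true} {_ , true} refl → adj-irrefl G _
       ; {_ , true} {_ , false} refl → adj-flip G (down (cell₀<cell₁ _))
       ; {_ , false} {_ , true} refl → down (cell₀<cell₁ _)
       ; {_ , false} {_ , false} refl → adj-irrefl G _ })
    (λ {p} {q} p<q → (p , true) , (q , false) , refl , refl , up (cell-mono _ _ p<q))
    where
    e : Fin s × Bool → Fin n
    e (i , true)  = a β (cell i (suc zero))
    e (i , false) = a (not β) (cell i zero)

  -- Each nonadjacent pair is contracted to one vertex. The two columns may coincide, in which case
  -- they form a clique.
  coMatching-model : (∀ i → adj G (a true i) (a false i) ≡ false) →
                     (∀ {i j} → i <ᶠ j → adj G (a true i) (a false j) ≡ true) →
                     IsModel G (K s) {Fin s × Bool} (λ (i , β) → a β (cell i zero)) proj₁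
  coMatching-model unmatched joined = complete-model
    (λ eq → proj₁ (cell-injective (column eq)))
    (λ p → (p , true) , refl)
    (λ { {_ , true} {_ , true} refl → adj-irrefl G _
       ; {_ , true} {_ , false} refl → unmatched _
       ; {_ , false} {_ , true} refl → adj-flip G (unmatched _)
       ; {_ , false} {_ , false} refl → adj-irrefl G _ })
    (λ {p} {q} p<q → (p , true) , (q , false) , refl , refl , joined (cell-mono _ _ p<q))

  -- The edge in cell (i , j) is used to join the classes i and j.
  Dart : Set
  Dart = (Fin s × Fin s) ⊎ (Σ[ i ∈ Fin s ] Σ[ j ∈ Fin s ] i ≢ j)

  -- Classes are independent because the two ends of an edge that is used go to different classes.
  -- The head of a diagonal cell is left out, as it would share a class with its own tail; the
  -- diagonal tails make every class nonempty.
  matching-model : (∀ i → adj G (a true i) (a false i) ≡ true) →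
                   (∀ β γ {i j} → i ≢ j → adj G (a β i) (a γ j) ≡ false) →
                   ∃[ e ] ∃[ c ] IsModel G (K s) {Dart} e c
  matching-model matched induced = e , c , complete-model (λ {x} {y} → consistent {x} {y})
    (λ p → inj₁ (p , p) , refl) (λ {x} {y} → independent {x} {y})
    (λ {p} {q} p<q → inj₁ (p , q) , inj₂ (p , q , <⇒≢ p<q) , refl , refl , matched _)
    where
    e : Dart → Fin n
    e (inj₁ (i , j))     = a true  (cell i (suc (suc j)))
    e (inj₂ (i , j , _)) = a false (cell i (suc (suc j)))

    c : Dart → Fin s
    c (inj₁ (i , j))     = i
    c (inj₂ (i , j , _)) = j

    same : ∀ {i j k l : Fin s} → cell i (suc (suc j)) ≡ cell k (suc (suc l)) → i ≡ k × j ≡ l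
    same eq with refl , refl ← cell-injective eq = refl , refl

    tail≢head : ∀ {i j} → a true i ≢ a false j
    tail≢head eq with refl ← column eq = adj⇒≢ G (matched _) eq

    consistent : ∀ {x y} → e x ≡ e y → c x ≡ c y
    consistent {inj₁ _} {inj₁ _} eq = proj₁ (same (column eq))
    consistent {inj₁ _} {inj₂ _} eq = ⊥-elim (tail≢head eq)
    consistent {inj₂ _} {inj₁ _} eq = ⊥-elim (tail≢head (sym eq))
    consistent {inj₂ _} {inj₂ _} eq = proj₂ (same (column eq))

    independent-column : ∀ β i j → adj G (a β i) (a β j) ≡ false
    independent-column β i j with i ≟ j
    ... | yes refl = adj-irrefl G _
    ... | no  i≢j  = induced β β i≢j

    independent : ∀ {x y} → c x ≡ c y → adj G (e x) (e y) ≡ false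
    independent {inj₁ _} {inj₁ _} _ = independent-column true _ _
    independent {inj₂ _} {inj₂ _} _ = independent-column false _ _
    independent {inj₁ (i , j)} {inj₂ (k , _ , k≢i)} refl =
      induced true false λ eq → k≢i (sym (proj₁ (same eq)))
    independent {inj₂ (k , _ , k≢i)} {inj₁ (i , j)} refl =
      induced false true λ eq → k≢i (proj₁ (same eq))

-- Complete tripartite graphs from hexagons

-- With three parts any two are cyclically consecutive, so the links of a hexagon account for every
-- pair of parts.
next-total : ∀ {p q} → p ≢ q → q ≡ next p ⊎ p ≡ next q
next-total {zero}             {zero}             p≢q = contradiction refl p≢q
next-total {zero}             {suc zero}         _   = inj₁ refl
next-total {zero}             {suc (suc zero)}   _   = inj₂ refl
next-total {suc zero}         {zero}             _   = inj₂ refl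
next-total {suc zero}         {suc zero}         p≢q = contradiction refl p≢q
next-total {suc zero}         {suc (suc zero)}   _   = inj₁ refl
next-total {suc (suc zero)}   {zero}             _   = inj₁ refl
next-total {suc (suc zero)}   {suc zero}         _   = inj₂ refl
next-total {suc (suc zero)}   {suc (suc zero)}   p≢q = contradiction refl p≢q

-- Hexagon `i` contributes only its two corners in the part of `i`, contracted to the vertex `i`.
-- Vertices in different parts are joined by a link from one hexagon to the other, in the direction
-- given by `next`.
tripartite-model : ∀ {G : Graph n} t (w : Fin (3 * t) → Hexagon G) →
                   (∀ {i j} → i ≢ j → Disjoint (w i) (w j)) →
                   (∀ p {i j} → i ≢ j → adj G (corner (w i) p true) (corner (w j) (next p) false) ≡ true) →
                   (∀ p b c {i j} → i ≢ j → adj G (corner (w i) p b) (corner (w j) p c) ≡ false) →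
                   IsModel G (Kₜₜₜ t) (λ (i , b) → corner (w i) (quotient {3} t i) b) proj₁
tripartite-model {G = G} t w disjoint joins independent = record
  { consistent = λ {(i , b)} {(j , c)} eq →
      decidable-stable (i ≟ j) λ i≢j → disjoint i≢j _ _ eq
  ; surjective = λ i → (i , true) , refl
  ; hom        = λ {(i , b)} {(j , c)} → hom i b j c
  ; lifts      = λ {i} {j} → lifts i j
  }
  where
  part : Fin (3 * t) → Fin 3
  part = quotient {3} t

  hom : ∀ i b j c → adj G (corner (w i) (part i) b) (corner (w j) (part j) c) ≡ true →
        adj (Kₜₜₜ t) i j ≡ true
  hom i b j c i~j with part i ≟ part j
  ... | no  _  = refl
  ... | yes eq rewrite sym eq with i ≟ j
  ...   | yes refl = adj-absurd i~j (gap-any (w i) (part i) b c)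
  ...   | no  i≢j  = adj-absurd i~j (independent (part i) b c i≢j)

  lifts : ∀ i j → adj (Kₜₜₜ t) i j ≡ true →
          ∃[ x ] ∃[ y ] proj₁ x ≡ i × proj₁ y ≡ j ×
            adj G (corner (w (proj₁ x)) (part (proj₁ x)) (proj₂ x))
                  (corner (w (proj₁ y)) (part (proj₁ y)) (proj₂ y)) ≡ true
  lifts i j i~j with next-total (λ (eq : part i ≡ part j) →
    adj-absurd i~j (cong not (dec-true (part i ≟ part j) eq)))
  ... | inj₁ eq = (i , true) , (j , false) , refl , refl ,
        subst (λ p → adj G (corner (w i) (part i) true) (corner (w j) p false) ≡ true) (sym eq)
          (joins (part i) (adj⇒≢ (Kₜₜₜ t) i~j))
  ... | inj₂ eq = (i , false) , (j , true) , refl , refl ,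
        adj-flip G
          (subst (λ p → adj G (corner (w j) (part j) true) (corner (w i) p false) ≡ true) (sym eq)
            (joins (part j) (adj⇒≢ (Kₜₜₜ t) i~j ∘ sym)))

-- Abstract, since unfolding it would unfold the iterated Ramsey number.
abstract
  positionPairs : List ((Fin 3 × Bool) × (Fin 3 × Bool))
  positionPairs = cartesianProduct positions positions

  ∈-positionPairs : ∀ x y → (x , y) ∈ positionPairs
  ∈-positionPairs x y = ∈-cartesianProduct⁺ (∈-positions x) (∈-positions y)

-- The sum bounds both the `s * (2 + s)` hexagons used to build `K s` and the `3 * t` used to build
-- `Kₜₜₜ t`.
packingBound : ℕ → ℕ → ℕ
packingBound s t = iteratedRamseyNumber positionPairs (s * (2 + s) + 3 * t)

-- Classes omitting a complete and a complete tripartite graph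

module _ (em : ExcludedMiddle 0ℓ) {𝓗 : GraphClass ℓ} (closed : ProjectionClosed 𝓗) where

  module _ {s} (K∉𝓗 : ¬ 𝓗 (K s)) {G : Graph n} (G∈𝓗 : 𝓗 G) (s*[2+s]≤m : s * (2 + s) ≤ m) where

    private
      no-model : ∀ {I : Set} {e : I → Fin n} {c : I → Fin s} → ¬ IsModel G (K s) e c
      no-model M = K∉𝓗 (model-member closed em M G∈𝓗)

    module _ (a : Bool → Fin m → Fin n)
             (distinct : ∀ β γ {i j} → i ≢ j → a β i ≢ a γ j)
             (homogeneous : ∀ β γ → ∃[ δ ] (∀ {i j} → i <ᶠ j → adj G (a β i) (a γ j) ≡ δ)) where

      private module C = Columns {G = G} a distinct s s*[2+s]≤m

      combined : ∀ {δ} → (∀ {i j} → i <ᶠ j → adj G (a true i) (a false j) ≡ δ) →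
                 (∀ {i j} → i <ᶠ j → adj G (a false i) (a true j) ≡ δ) →
                 ∀ {i j} → i ≢ j → adj G (a true i) (a false j) ≡ δ
      combined up down {i} {j} i≢j with <-cmp i j
      ... | tri< i<j _ _ = up i<j
      ... | tri≈ _ eq _  = contradiction eq i≢j
      ... | tri> _ _ j<i = adj-flip G (down j<i)

      -- Adjacency that depended on the order of the indices would give a half graph, in one of its
      -- two orientations.
      off-diagonal-constant : ∃[ δ ] (∀ {i j} → i ≢ j → adj G (a true i) (a false j) ≡ δ)
      off-diagonal-constant with homogeneous true false | homogeneous false true
      ... | true  , up | false , down = contradiction (proj₂ (C.halfGraph-model true up down)) no-model
      ... | false , up | true  , down = contradiction (proj₂ (C.halfGraph-model false down up)) no-model
      ... | true  , up | true  , down = true  , combined up down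
      ... | false , up | false , down = false , combined up down

      unmatched : (∀ i → adj G (a true i) (a false i) ≡ false) →
                  ∀ {i j} → i ≢ j → adj G (a true i) (a false j) ≡ false
      unmatched diagonal with off-diagonal-constant
      ... | false , eq = eq
      ... | true  , eq = contradiction (C.coMatching-model diagonal (eq ∘ <⇒≢)) no-model

    matched : (a : Bool → Fin m → Fin n) →
              (∀ β γ {i j} → i ≢ j → a β i ≢ a γ j) →
              (∀ β γ → ∃[ δ ] (∀ {i j} → i <ᶠ j → adj G (a β i) (a γ j) ≡ δ)) →
              (∀ i → adj G (a true i) (a false i) ≡ true) →
              ∀ {i j} → i ≢ j → adj G (a true i) (a false j) ≡ true
    matched a distinct homogeneous diagonal with off-diagonal-constant a distinct homogeneous
    ... | true  , eq = eq
    ... | false , eq = contradiction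
            (proj₂ (proj₂ (Columns.matching-model {G = G} a distinct s s*[2+s]≤m diagonal induced))) no-model
      where
      induced : ∀ β γ {i j} → i ≢ j → adj G (a β i) (a γ j) ≡ false
      induced true  false i≢j = eq i≢j
      induced false true  i≢j = adj-flip G (eq (i≢j ∘ sym))
      -- A column paired with itself has an edgeless diagonal, so `unmatched` shows that the column
      -- is independent.
      induced true  true  = unmatched (λ _ → a true) (λ _ _ → distinct true true)
                              (λ _ _ → homogeneous true true) (λ _ → adj-irrefl G _)
      induced false false = unmatched (λ _ → a false) (λ _ _ → distinct false false)
                              (λ _ _ → homogeneous false false) (λ _ → adj-irrefl G _)

  -- Links and gaps give the diagonal adjacency of two columns of corners; `matched` and `unmatched`
  -- carry it over to pairs of different hexagons, which yields the blow-up required by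
  -- `tripartite-model`.
  no-homogeneous-packing :
    ∀ s t → ¬ 𝓗 (K s) → ¬ 𝓗 (Kₜₜₜ t) → {G : Graph n} → 𝓗 G →
    s * (2 + s) ≤ m → 3 * t ≤ m → (w : Fin m → Hexagon G) →
    (∀ {i j} → i ≢ j → Disjoint (w i) (w j)) →
    ¬ (∀ x y → ∃[ δ ] (∀ {i j} → i <ᶠ j → adj G (cornerAt (w i) x) (cornerAt (w j) y) ≡ δ))
  no-homogeneous-packing {n} {m} s t K∉𝓗 Kₜₜₜ∉𝓗 {G} G∈𝓗 s*[2+s]≤m 3*t≤m w disjoint homogeneous =
    Kₜₜₜ∉𝓗 (model-member closed em {H = Kₜₜₜ t}
      (tripartite-model t (w ∘ ι) (disjoint ∘ ι-≢) (λ p → linked p ∘ ι-≢) (λ p b c → gapped p b c ∘ ι-≢))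
      G∈𝓗)
    where
    ι : Fin (3 * t) → Fin m
    ι i = inject≤ i 3*t≤m

    ι-≢ : ∀ {i j} → i ≢ j → ι i ≢ ι j
    ι-≢ i≢j eq = i≢j (inject≤-injective _ _ _ _ eq)

    columns : (x y : Fin 3 × Bool) → Bool → Fin m → Fin n
    columns x y β i = cornerAt (w i) (if β then x else y)

    linked : ∀ p {i j} → i ≢ j → adj G (corner (w i) p true) (corner (w j) (next p) false) ≡ true
    linked p = matched K∉𝓗 G∈𝓗 s*[2+s]≤m (columns (p , true) (next p , false))
      (λ _ _ i≢j → disjoint i≢j _ _) (λ _ _ → homogeneous _ _) (λ i → link (w i) p)

    gapped : ∀ p b c {i j} → i ≢ j → adj G (corner (w i) p b) (corner (w j) p c) ≡ false
    gapped p b c = unmatched K∉𝓗 G∈𝓗 s*[2+s]≤m (columns (p , b) (p , c))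
      (λ _ _ i≢j → disjoint i≢j _ _) (λ _ _ → homogeneous _ _) (λ i → gap-any (w i) p b c)

  no-packing : ∀ s t → ¬ 𝓗 (K s) → ¬ 𝓗 (Kₜₜₜ t) → {G : Graph n} → 𝓗 G →
               (ws : List (Hexagon G)) → length ws ≡ packingBound s t → ¬ AllPairs Disjoint ws
  no-packing s t K∉𝓗 Kₜₜₜ∉𝓗 {G} G∈𝓗 ws len disjoint
    with us , us⊆ws , m≤ , mono ← iterated-ramsey
           -- One colouring of the pairs of hexagons for each pair of corner positions.
           (λ (x , y) w w′ → adj G (cornerAt w x) (cornerAt w′ y))
           positionPairs (s * (2 + s) + 3 * t) ws (ℕ.≤-reflexive (sym len)) =
    no-homogeneous-packing s t K∉𝓗 Kₜₜₜ∉𝓗 G∈𝓗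
      (ℕ.≤-trans (ℕ.m≤m+n _ _) m≤) (ℕ.≤-trans (ℕ.m≤n+m _ (s * (2 + s))) m≤)
      (lookup us) pairwise-disjoint homogeneous
    where
    pairwise-disjoint : ∀ {i j} → i ≢ j → Disjoint (lookup us i) (lookup us j)
    pairwise-disjoint {i} {j} i≢j x y with <-cmp i j
    ... | tri< i<j _ _ = AllPairs-lookup (AllPairs-resp-⊆ us⊆ws disjoint) i<j x y
    ... | tri≈ _ eq _  = contradiction eq i≢j
    ... | tri> _ _ j<i = AllPairs-lookup (AllPairs-resp-⊆ us⊆ws disjoint) j<i y x ∘ sym

    homogeneous : ∀ x y →
      ∃[ δ ] (∀ {i j} → i <ᶠ j → adj G (cornerAt (lookup us i) x) (cornerAt (lookup us j) y) ≡ δ)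
    homogeneous x y
      with δ , pairs ← All.lookup mono (∈-positionPairs x y) =
      δ , AllPairs-lookup pairs

  bounded-distance : ∀ s t → ¬ 𝓗 (K s) → ¬ 𝓗 (Kₜₜₜ t) →
                     (H : Graph n) → 𝓗 H → DistanceAtMost (packingBound s t * 6) H
  bounded-distance s t K∉𝓗 Kₜₜₜ∉𝓗 H H∈𝓗 with pack em (packingBound s t) H
  ... | inj₁ (_ , d≤ , D)          = deletable⇒distance em d≤ D
  ... | inj₂ (ws , len , disjoint) = contradiction disjoint (no-packing s t K∉𝓗 Kₜₜₜ∉𝓗 H∈𝓗 ws len)

-- The three alternatives

-- Membership in the class lives at level `ℓ`, while statements about hexagons, models and deletions
-- live at level zero.
em-lower : ExcludedMiddle ℓ → ExcludedMiddle 0ℓ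
em-lower {ℓ} em {P} = map′ lower lift (em {Lift ℓ P})

∀⊎∃¬ : ExcludedMiddle ℓ → (P : ℕ → Set ℓ) → (∀ t → P t) ⊎ ∃[ t ] ¬ P t
∀⊎∃¬ em P with em {∃[ t ] ¬ P t}
... | yes counterexample = inj₂ counterexample
... | no  ∄¬             = inj₁ λ t → decidable-stable em λ ¬Pt → ∄¬ (t , ¬Pt)

theorem1p14 : {ℓ : Level} → ExcludedMiddle ℓ → (𝓗 : GraphClass ℓ) → ProjectionClosed 𝓗 →
    (∀ t → t ≥ 1 → 𝓗 (K t))
    ⊎ (∀ t → t ≥ 1 → 𝓗 (Kₜₜₜ t))
    ⊎ (∃[ μ ] (∀ {n} (H : Graph n) → 𝓗 H → DistanceAtMost μ H))
theorem1p14 em 𝓗 closed with ∀⊎∃¬ em (λ t → 𝓗 (K t)) | ∀⊎∃¬ em (λ t → 𝓗 (Kₜₜₜ t))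
... | inj₁ all        | _                 = inj₁ λ t _ → all t
... | inj₂ _          | inj₁ all          = inj₂ (inj₁ λ t _ → all t)
... | inj₂ (s , K∉𝓗) | inj₂ (t , Kₜₜₜ∉𝓗) =
      inj₂ (inj₂ (_ , bounded-distance (em-lower em) closed s t K∉𝓗 Kₜₜₜ∉𝓗))
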